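{- Let $n\ge 4$ and let $p_1,p_2,\ldots,p_{n-2}$ be a rearrangement of $3,4,\ldots,n$. Then the three positional marked patterns $P_1=1\underline{2}p_1\cdots p_{n-2}$, $P_2=\underline{2}1p_1\cdots p_{n-2}$ and $P_3=2\underline{1}p_1\cdots p_{n-2}$ are pairwise $pmp$-Wilf equivalent.
   Context: A positional marked pattern of length $k$ is a permutation $\tau=\tau_1\cdots\tau_k$ of $[k]$ with exactly one entry underlined; $\pi(\tau)$ is the permutation obtained by removing the underline and $u(\tau)$ is the position of the underlined entry. For a word $w$ with distinct letters, $red(w)$ replaces the $i$-th smallest letter by $i$. For $\sigma\in S_N$, $\sigma$ has a $\tau$-match at position $\ell$ if there are indices $i_1<\cdots<i_k$ with $i_{u(\tau)}=\ell$ and $red(\sigma_{i_1}\cdots\sigma_{i_k})=\pi(\tau)$; $pmp_\tau(\sigma)$ is the number of such positions $\ell$. Two positional marked patterns $\tau,\tau'$ are $pmp$-Wilf equivalent if $\sum_{\sigma\in S_N}x^{pmp_\tau(\sigma)}=\sum_{\sigma\in S_N}x^{pmp_{\tau'}(\sigma)}$ for all $N\ge1$. In $P_1$ the underlined entry is the $2$ in position 2; in $P_2$ it is the $2$ in position 1; in $P_3$ it is the $1$ in position 2. -}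

module Defs where

open import Data.Nat using (ℕ; zero; suc; _+_; _∸_; _≡ᵇ_; _<ᵇ_; _≤_)
open import Data.Bool using (Bool; true; false; _∧_; not; if_then_else_)
open import Data.List using (List; []; _∷_; map; length; concatMap; _++_; applyUpTo)
open import Data.Bool.ListAction using (any)
open import Relation.Binary.PropositionalEquality using (_≡_)
open import Relation.Nullary.Decidable using (⌊_⌋)
open import Data.List.Properties using (≡-dec)
import Data.Nat as ℕ

countᵇ : {A : Set} → (A → Bool) → List A → ℕ
countᵇ P []       = 0
countᵇ P (x ∷ xs) = if P x then suc (countᵇ P xs) else countᵇ P xs

filterᵇ : {A : Set} → (A → Bool) → List A → List A
filterᵇ P []       = []
filterᵇ P (x ∷ xs) = if P x then x ∷ filterᵇ P xs else filterᵇ P xs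

-- A positional marked pattern: the permutation π(τ) written as a list of
-- values 1..k, together with the (1-indexed) position u(τ) of the
-- underlined entry.
record MarkedPattern : Set where
  constructor mp
  field
    perm : List ℕ
    mark : ℕ
open MarkedPattern public

range : ℕ → ℕ → List ℕ
range a n = applyUpTo (λ i → a + i) n

[1‥_] : ℕ → List ℕ
[1‥ N ] = range 1 N

-- 1-indexed access to a list (default 0 outside the range)
at : List ℕ → ℕ → ℕ
at []       _             = 0
at (x ∷ xs) zero          = 0
at (x ∷ xs) (suc zero)    = x
at (x ∷ xs) (suc (suc i)) = at xs (suc i)

red : List ℕ → List ℕ
red w = map (λ a → suc (countᵇ (λ b → b <ᵇ a) w)) w

-- all subsequences of a list (for an increasing list: all increasing
-- index tuples)
subseqs : List ℕ → List (List ℕ)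
subseqs []       = [] ∷ []
subseqs (x ∷ xs) = map (x ∷_) (subseqs xs) ++ subseqs xs

eqList : List ℕ → List ℕ → Bool
eqList v w = ⌊ ≡-dec ℕ._≟_ v w ⌋

matchAt : MarkedPattern → List ℕ → ℕ → Bool
matchAt τ σ ℓ =
  any (λ I → (length I ≡ᵇ length (perm τ))
             ∧ (at I (mark τ) ≡ᵇ ℓ)
             ∧ eqList (red (map (at σ) I)) (perm τ))
      (subseqs [1‥ length σ ])

pmp : MarkedPattern → List ℕ → ℕ
pmp τ σ = countᵇ (λ ℓ → matchAt τ σ ℓ) [1‥ length σ ]

words : List ℕ → ℕ → List (List ℕ)
words L zero    = [] ∷ []
words L (suc n) = concatMap (λ a → map (a ∷_) (words L n)) L

distinct : List ℕ → Bool
distinct []       = true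
distinct (x ∷ xs) = not (any (λ y → x ≡ᵇ y) xs) ∧ distinct xs

-- S_N, listed as one-line notations: the words of length N over [1..N]
-- with distinct letters
S : ℕ → List (List ℕ)
S N = filterᵇ distinct (words [1‥ N ] N)

-- coefficient of x^k in  Σ_{σ ∈ S_N} x^{pmp_τ(σ)}
coeff : MarkedPattern → ℕ → ℕ → ℕ
coeff τ N k = countᵇ (λ σ → pmp τ σ ≡ᵇ k) (S N)

-- pmp-Wilf equivalence: the generating polynomials agree for all N ≥ 1,
-- i.e. all their coefficients agree
PmpWilfEquiv : MarkedPattern → MarkedPattern → Set
PmpWilfEquiv τ τ' = ∀ N → 1 ≤ N → ∀ k → coeff τ N k ≡ coeff τ' N k

P₁ P₂ P₃ : List ℕ → MarkedPattern
P₁ p = mp (1 ∷ 2 ∷ p) 2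
P₂ p = mp (2 ∷ 1 ∷ p) 1
P₃ p = mp (2 ∷ 1 ∷ p) 2

{-# OPTIONS --safe #-}

-- Call a grid point (x , y) inner if a copy of p lies strictly to the right of x and above y.
-- Column j is a match of P₁ iff its entry is inner and not the smallest among columns ≤ j, and a
-- match of P₃ iff its entry is smaller than some b in columns < j with (j , b) inner. Building σ
-- from right to left, the inner points of column j are known when σ j is chosen, and if some
-- unused value is inner there, exactly one choice of an inner value fails to give a match: the
-- smallest for P₁, the largest for P₃. To turn one rule into the other at column t, the forbidden
-- value is raised step by step: exchanging two consecutive inner unused values r < v, one of them
-- σ t, only moves entries in columns ≤ t with values ≤ v, where every grid point is inner anyway.
-- The argument only uses that being inner is antitone and depends on nothing but the points to the
-- upper right, which is symmetric under inversion of σ; inversion preserves P₁ and turns P₃ into P₂.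
module Submission where

open import Defs
open import Data.Bool using (Bool; true; false; T; _∧_)
open import Data.Bool.ListAction using (any)
open import Data.Bool.Properties using (T-∧; T-≡; ¬-not; T?)
open import Data.Empty using (⊥-elim)
open import Data.List using (List; []; _∷_; map; length; _++_; applyUpTo; concatMap)
open import Data.List.Properties using (map-applyUpTo; length-applyUpTo; length-map; length-++; map-∘; map-id; map-cong; ∷-injective; ≡-dec)
open import Data.List.Membership.Propositional using (_∈_; find; lose)
open import Data.List.Membership.Propositional.Properties using (∈-applyUpTo⁺; ∈-applyUpTo⁻; ∈-map⁺; ∈-map⁻; ∈-++⁺ˡ; ∈-++⁺ʳ; ∈-++⁻; ∈-concatMap⁺; ∈-concatMap⁻; ∈-∃++)
open import Data.List.Membership.Propositional.Properties.WithK using (unique∧set⇒bag)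
open import Data.List.Relation.Binary.BagAndSetEquality using (∼bag⇒↭)
open import Data.List.Relation.Binary.Permutation.Propositional as ↭ using (_↭_)
open import Data.List.Relation.Binary.Permutation.Propositional.Properties using (∈-resp-↭)
open import Data.List.Relation.Unary.All as All using (All; []; _∷_)
import Data.List.Relation.Unary.All.Properties as All
open import Data.List.Relation.Unary.AllPairs using (AllPairs; []; _∷_)
import Data.List.Relation.Unary.AllPairs.Properties as AllPairs
open import Data.List.Relation.Unary.Any as Any using (Any; here; there; any?)
open import Data.List.Relation.Unary.Any.Properties using (any⁺; any⁻)
open import Data.List.Relation.Unary.Unique.Propositional using (Unique)
import Data.List.Relation.Unary.Unique.Propositional.Properties as Unique
open import Data.Nat using (ℕ; zero; suc; _+_; _∸_; _≤_; _<_; _≡ᵇ_; _<ᵇ_; z≤n; s≤s; _≟_; _≤?_; _<?_)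
open import Data.Nat.Properties
open import Data.List.Membership.DecPropositional _≟_ using (_∈?_)
open import Data.Product using (∃; _×_; _,_; proj₁; proj₂)
open import Data.Sum as Sum using (_⊎_; inj₁; inj₂)
open import Function using (_∘_; _⇔_; mk⇔; Equivalence)
open import Function.Construct.Composition using (_⇔-∘_)
open import Relation.Binary.PropositionalEquality using (_≡_; _≢_; refl; sym; trans; cong; cong₂; subst; subst₂; module ≡-Reasoning)
open import Relation.Nullary using (¬_; Dec; yes; no; contradiction)
open import Relation.Nullary.Decidable using (⌊_⌋; toWitness; fromWitness; map′; _×-dec_; _⊎-dec_)
open import Relation.Unary using (Decidable)

open Equivalence using (to; from)

private variable
  A B : Set
  N : ℕ
  σ σ′ : List ℕ

-- Counting and duplicate-free lists

T-⇔⇒≡ : {a b : Bool} → (T a → T b) → (T b → T a) → a ≡ b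
T-⇔⇒≡ {false} {false} f g = refl
T-⇔⇒≡ {false} {true}  f g = ⊥-elim (g _)
T-⇔⇒≡ {true}  {false} f g = ⊥-elim (f _)
T-⇔⇒≡ {true}  {true}  f g = refl

countᵇ-cong : {P Q : A → Bool} (xs : List A) → (∀ {x} → x ∈ xs → P x ≡ Q x) →
              countᵇ P xs ≡ countᵇ Q xs
countᵇ-cong []       eq = refl
countᵇ-cong (x ∷ xs) eq rewrite eq (here refl) | countᵇ-cong xs (eq ∘ there) = refl

countᵇ-map : (P : B → Bool) (f : A → B) (xs : List A) →
             countᵇ P (map f xs) ≡ countᵇ (P ∘ f) xs
countᵇ-map P f []       = refl
countᵇ-map P f (x ∷ xs) rewrite countᵇ-map P f xs = refl

countᵇ-↭ : (P : A → Bool) {xs ys : List A} → xs ↭ ys → countᵇ P xs ≡ countᵇ P ys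
countᵇ-↭ P ↭.refl = refl
countᵇ-↭ P (↭.prep x p) rewrite countᵇ-↭ P p = refl
countᵇ-↭ P (↭.swap x y p) with P x | P y
... | true  | true  = cong (suc ∘ suc) (countᵇ-↭ P p)
... | true  | false = cong suc (countᵇ-↭ P p)
... | false | true  = cong suc (countᵇ-↭ P p)
... | false | false = countᵇ-↭ P p
countᵇ-↭ P (↭.trans p q) = trans (countᵇ-↭ P p) (countᵇ-↭ P q)

Unique-map : (f : A → B) {xs : List A} →
             (∀ {x y} → x ∈ xs → y ∈ xs → f x ≡ f y → x ≡ y) → Unique xs → Unique (map f xs)
Unique-map f inj []         = []
Unique-map f {x ∷ xs} inj (x∉ ∷ u) =
  All.tabulate (λ y∈ fx≡ → let z , z∈ , y≡ = ∈-map⁻ f y∈ in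
    All.lookup x∉ z∈ (inj (here refl) (there z∈) (trans fx≡ y≡)))
  ∷ Unique-map f (λ p q → inj (there p) (there q)) u

-- Induction on `xs`: its head occurs in `ys`, and deleting that occurrence leaves a list that still
-- contains the tail, because the tail avoids the head.
Unique-⊆⇒length-≤ : {xs ys : List A} → Unique xs → (∀ {x} → x ∈ xs → x ∈ ys) → length xs ≤ length ys
Unique-⊆⇒length-≤ {xs = []} u sub = z≤n
Unique-⊆⇒length-≤ {xs = x ∷ xs} (x∉ ∷ u) sub with ∈-∃++ (sub (here refl))
... | as , bs , refl = begin
  suc (length xs)          ≤⟨ s≤s (Unique-⊆⇒length-≤ u λ y∈ → drop y∈ (∈-++⁻ as (sub (there y∈)))) ⟩
  suc (length (as ++ bs))  ≡⟨ cong suc (length-++ as) ⟩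
  suc (length as + length bs) ≡⟨ +-suc (length as) (length bs) ⟨
  length as + suc (length bs) ≡⟨ length-++ as ⟨
  length (as ++ x ∷ bs)    ∎
  where
  open ≤-Reasoning
  drop : ∀ {y} → y ∈ xs → (y ∈ as) ⊎ (y ∈ x ∷ bs) → y ∈ as ++ bs
  drop y∈ (inj₁ p)            = ∈-++⁺ˡ p
  drop y∈ (inj₂ (here refl))  = contradiction refl (All.lookup x∉ y∈)
  drop y∈ (inj₂ (there p))    = ∈-++⁺ʳ as p

map-cong-∈ : {f g : ℕ → ℕ} (xs : List ℕ) → (∀ {x} → x ∈ xs → f x ≡ g x) → map f xs ≡ map g xs
map-cong-∈ []       h = refl
map-cong-∈ (x ∷ xs) h = cong₂ _∷_ (h (here refl)) (map-cong-∈ xs (h ∘ there))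

-- Ranges and access by position

InRange : ℕ → ℕ → Set
InRange N i = 1 ≤ i × i ≤ N

∈-[1‥]⁺ : ∀ {i} → InRange N i → i ∈ [1‥ N ]
∈-[1‥]⁺ {i = suc i} (_ , le) = ∈-applyUpTo⁺ (1 +_) le

∈-[1‥]⁻ : ∀ {i} → i ∈ [1‥ N ] → InRange N i
∈-[1‥]⁻ i∈ with _ , lt , refl ← ∈-applyUpTo⁻ (1 +_) i∈ = s≤s z≤n , lt

[1‥]-Unique : ∀ N → Unique [1‥ N ]
[1‥]-Unique N = Unique.applyUpTo⁺₁ (1 +_) N λ i<j _ eq → <⇒≢ i<j (suc-injective eq)

map-at : (σ : List ℕ) → map (at σ) [1‥ length σ ] ≡ σ
map-at σ = trans (map-applyUpTo (1 +_) (at σ) (length σ)) (go σ)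
  where
  go : (σ : List ℕ) → applyUpTo (at σ ∘ suc) (length σ) ≡ σ
  go []       = refl
  go (x ∷ xs) = cong (x ∷_) (go xs)

at-∈ : (σ : List ℕ) → ∀ {i} → InRange (length σ) i → at σ i ∈ σ
at-∈ (x ∷ σ) {suc zero}    _            = here refl
at-∈ (x ∷ σ) {suc (suc i)} (_ , s≤s le) = there (at-∈ σ (s≤s z≤n , le))

at-injective : Unique σ → ∀ {i j} → InRange (length σ) i → InRange (length σ) j →
               at σ i ≡ at σ j → i ≡ j
at-injective (x∉ ∷ u) {suc zero} {suc zero} _ _ eq = refl
at-injective {_ ∷ σ} (x∉ ∷ u) {suc zero} {suc (suc j)} _ (_ , s≤s le) eq =
  contradiction eq (All.lookup x∉ (at-∈ σ (s≤s z≤n , le)))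
at-injective {_ ∷ σ} (x∉ ∷ u) {suc (suc i)} {suc zero} (_ , s≤s le) _ eq =
  contradiction (sym eq) (All.lookup x∉ (at-∈ σ (s≤s z≤n , le)))
at-injective {_ ∷ σ} (x∉ ∷ u) {suc (suc i)} {suc (suc j)} (_ , s≤s le) (_ , s≤s le′) eq =
  cong suc (at-injective u (s≤s z≤n , le) (s≤s z≤n , le′) eq)

at-map : (f : ℕ → ℕ) (xs : List ℕ) → ∀ {i} → InRange (length xs) i → at (map f xs) i ≡ f (at xs i)
at-map f (x ∷ xs) {suc zero}    _            = refl
at-map f (x ∷ xs) {suc (suc i)} (_ , s≤s le) = at-map f xs (s≤s z≤n , le)

length-[1‥] : ∀ N → length [1‥ N ] ≡ N
length-[1‥] = length-applyUpTo (1 +_)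

at-applyUpTo : (f : ℕ → ℕ) → ∀ {i n} → i < n → at (applyUpTo f n) (suc i) ≡ f i
at-applyUpTo f {zero}  {suc n} lt       = refl
at-applyUpTo f {suc i} {suc n} (s≤s lt) = at-applyUpTo (f ∘ suc) lt

at-map-[1‥] : (f : ℕ → ℕ) → ∀ {i} → InRange N i → at (map f [1‥ N ]) i ≡ f i
at-map-[1‥] {N} f {suc i} (_ , le) =
  trans (cong (λ w → at w (suc i)) (map-applyUpTo (1 +_) f N)) (at-applyUpTo (f ∘ suc) le)

-- Permutations and the list `S N`

record Perm (N : ℕ) (σ : List ℕ) : Set where
  field
    len     : length σ ≡ N
    bounded : ∀ {i} → InRange N i → InRange N (at σ i)
    inj     : ∀ {i j} → InRange N i → InRange N j → at σ i ≡ at σ j → i ≡ j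

  map-at′ : map (at σ) [1‥ N ] ≡ σ
  map-at′ = subst (λ n → map (at σ) [1‥ n ] ≡ σ) len (map-at σ)

  ∈⇒at : ∀ {v} → v ∈ σ → ∃ λ i → InRange N i × at σ i ≡ v
  ∈⇒at v∈ with i , i∈ , eq ← ∈-map⁻ (at σ) (subst (_ ∈_) (sym map-at′) v∈) = i , ∈-[1‥]⁻ i∈ , sym eq

  entries : ∀ {v} → v ∈ σ → InRange N v
  entries v∈ with _ , r , refl ← ∈⇒at v∈ = bounded r

  unique : Unique σ
  unique = subst Unique map-at′
    (Unique-map (at σ) (λ p q → inj (∈-[1‥]⁻ p) (∈-[1‥]⁻ q)) ([1‥]-Unique N))

  -- Pigeonhole: a missing `v` put in front of `σ` would give `N + 1` distinct elements of
  -- `[1‥ N ]`.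
  surj : ∀ {v} → InRange N v → v ∈ σ
  surj {v} r with v ∈? σ
  ... | yes v∈ = v∈
  ... | no v∉ = contradiction
    (Unique-⊆⇒length-≤ {ys = [1‥ N ]} (All.tabulate (λ w∈ eq → v∉ (subst (_∈ σ) (sym eq) w∈)) ∷ unique)
      λ { (here refl) → ∈-[1‥]⁺ r ; (there w∈) → ∈-[1‥]⁺ (entries w∈) })
    (subst₂ (λ a b → ¬ (suc a ≤ b)) (sym len) (sym (length-[1‥] N)) (<-irrefl refl))

  ↭-[1‥] : σ ↭ [1‥ N ]
  ↭-[1‥] = ∼bag⇒↭ (unique∧set⇒bag unique ([1‥]-Unique N) (mk⇔ (∈-[1‥]⁺ ∘ entries) (surj ∘ ∈-[1‥]⁻)))

Perm-ext : Perm N σ → Perm N σ′ → (∀ {i} → InRange N i → at σ i ≡ at σ′ i) → σ ≡ σ′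
Perm-ext {N} {σ} {σ′} s s′ eq = begin
  σ                      ≡⟨ Perm.map-at′ s ⟨
  map (at σ) [1‥ N ]     ≡⟨ map-cong-∈ [1‥ N ] (eq ∘ ∈-[1‥]⁻) ⟩
  map (at σ′) [1‥ N ]    ≡⟨ Perm.map-at′ s′ ⟩
  σ′                     ∎
  where open ≡-Reasoning

∈-filterᵇ⁺ : {P : A → Bool} {xs : List A} → ∀ {x} → x ∈ xs → T (P x) → x ∈ filterᵇ P xs
∈-filterᵇ⁺ {P = P} {y ∷ xs} (here refl) px with P y
... | true = here refl
∈-filterᵇ⁺ {P = P} {y ∷ xs} (there x∈) px with P y
... | true  = there (∈-filterᵇ⁺ x∈ px)
... | false = ∈-filterᵇ⁺ x∈ px

∈-filterᵇ⁻ : {P : A → Bool} (xs : List A) → ∀ {x} → x ∈ filterᵇ P xs → x ∈ xs × T (P x)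
∈-filterᵇ⁻ {P = P} (y ∷ xs) x∈ with P y in eq
∈-filterᵇ⁻ (y ∷ xs) (here refl) | true  = here refl , subst T (sym eq) _
∈-filterᵇ⁻ (y ∷ xs) (there x∈)  | true  = let p , q = ∈-filterᵇ⁻ xs x∈ in there p , q
∈-filterᵇ⁻ (y ∷ xs) x∈          | false = let p , q = ∈-filterᵇ⁻ xs x∈ in there p , q

Unique-filterᵇ : (P : A → Bool) {xs : List A} → Unique xs → Unique (filterᵇ P xs)
Unique-filterᵇ P [] = []
Unique-filterᵇ P {x ∷ xs} (x∉ ∷ u) with P x
... | true  = All.tabulate (λ y∈ → All.lookup x∉ (proj₁ (∈-filterᵇ⁻ xs y∈))) ∷ Unique-filterᵇ P u
... | false = Unique-filterᵇ P u

∈-words⁺ : (L : List ℕ) → ∀ {w} → All (_∈ L) w → w ∈ words L (length w)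
∈-words⁺ L []         = here refl
∈-words⁺ L {a ∷ w} (a∈ ∷ w∈) =
  ∈-concatMap⁺ (λ a → map (a ∷_) (words L (length w))) (lose a∈ (∈-map⁺ (a ∷_) (∈-words⁺ L w∈)))

∈-words⁻ : (L : List ℕ) → ∀ n {w} → w ∈ words L n → length w ≡ n × All (_∈ L) w
∈-words⁻ L zero    (here refl) = refl , []
∈-words⁻ L (suc n) w∈
  with a , a∈ , w∈′ ← find (∈-concatMap⁻ (λ a → map (a ∷_) (words L n)) {xs = L} w∈)
  with w′ , w′∈ , refl ← ∈-map⁻ (a ∷_) w∈′
  = let l , al = ∈-words⁻ L n w′∈ in cong suc l , a∈ ∷ al

Unique-words : {L : List ℕ} → Unique L → ∀ n → Unique (words L n)
Unique-words {L} uL zero    = [] ∷ []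
Unique-words {L} uL (suc n) = go L uL
  where
  go : ∀ xs → Unique xs → Unique (concatMap (λ a → map (a ∷_) (words L n)) xs)
  go []       []       = []
  go (x ∷ xs) (x∉ ∷ u) = Unique.++⁺
    (Unique.map⁺ (λ { refl → refl }) (Unique-words uL n)) (go xs u)
    λ { (p , q) → disjoint (∈-map⁻ (x ∷_) p)
                    (find (∈-concatMap⁻ (λ a → map (a ∷_) (words L n)) {xs = xs} q)) }
    where
    disjoint : ∀ {w} → (∃ λ v → v ∈ words L n × w ≡ x ∷ v) →
               ¬ (∃ λ a → a ∈ xs × w ∈ map (a ∷_) (words L n))
    disjoint (v , _ , refl) (a , a∈ , q) with _ , _ , refl ← ∈-map⁻ (a ∷_) q = All.lookup x∉ a∈ refl

distinct⇒Unique : (w : List ℕ) → T (distinct w) → Unique w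
distinct⇒Unique []      _ = []
distinct⇒Unique (x ∷ w) d with any (x ≡ᵇ_) w in eq
... | false = All.tabulate (λ {y} y∈ x≡y →
      subst T eq (any⁺ (x ≡ᵇ_) (lose y∈ (≡⇒≡ᵇ x y x≡y)))) ∷ distinct⇒Unique w d

Unique⇒distinct : (w : List ℕ) → Unique w → T (distinct w)
Unique⇒distinct []      _ = _
Unique⇒distinct (x ∷ w) (x∉ ∷ u) with any (x ≡ᵇ_) w in eq
... | false = Unique⇒distinct w u
... | true  with y , y∈ , t ← find (any⁻ (x ≡ᵇ_) w (subst T (sym eq) _))
            = All.lookup x∉ y∈ (≡ᵇ⇒≡ x y t)

S-Unique : ∀ N → Unique (S N)
S-Unique N = Unique-filterᵇ distinct (Unique-words ([1‥]-Unique N) N)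

∈-S⇒Perm : σ ∈ S N → Perm N σ
∈-S⇒Perm {σ} {N} σ∈ with ∈-filterᵇ⁻ (words [1‥ N ] N) σ∈
... | σ∈w , d with ∈-words⁻ [1‥ N ] N σ∈w
... | refl , al = record
  { len     = refl
  ; bounded = λ r → ∈-[1‥]⁻ (All.lookup al (at-∈ σ r))
  ; inj     = at-injective (distinct⇒Unique σ d)
  }

Perm⇒∈-S : Perm N σ → σ ∈ S N
Perm⇒∈-S {N} {σ} s = ∈-filterᵇ⁺
  (subst (λ n → σ ∈ words [1‥ N ] n) len
    (∈-words⁺ [1‥ N ] (All.tabulate (∈-[1‥]⁺ ∘ entries))))
  (Unique⇒distinct σ unique)
  where open Perm s

-- Involutions on permutations

record Involution (N : ℕ) (φ : List ℕ → List ℕ) : Set where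
  field
    preserves  : Perm N σ → Perm N (φ σ)
    involutive : Perm N σ → φ (φ σ) ≡ σ

-- An involution permutes the duplicate-free list `S N`, so mapping it over `S N` only reorders that
-- list, and counting ignores order.
countᵇ-Involution : {φ : List ℕ → List ℕ} → Involution N φ → (P : List ℕ → Bool) →
                    countᵇ (P ∘ φ) (S N) ≡ countᵇ P (S N)
countᵇ-Involution {N} {φ} I P = begin
  countᵇ (P ∘ φ) (S N)   ≡⟨ countᵇ-map P φ (S N) ⟨
  countᵇ P (map φ (S N)) ≡⟨ countᵇ-↭ P (∼bag⇒↭ (unique∧set⇒bag
      (Unique-map φ (λ p q eq → begin
        _         ≡⟨ involutive (∈-S⇒Perm p) ⟨
        φ (φ _)   ≡⟨ cong φ eq ⟩
        φ (φ _)   ≡⟨ involutive (∈-S⇒Perm q) ⟩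
        _         ∎) (S-Unique N))
      (S-Unique N)
      (mk⇔ image preimage))) ⟩
  countᵇ P (S N)         ∎
  where
  open Involution I
  open ≡-Reasoning
  image : ∀ {τ} → τ ∈ map φ (S N) → τ ∈ S N
  image τ∈ with _ , σ∈ , refl ← ∈-map⁻ φ τ∈ = Perm⇒∈-S (preserves (∈-S⇒Perm σ∈))
  preimage : ∀ {τ} → τ ∈ S N → τ ∈ map φ (S N)
  preimage τ∈ = subst (_∈ map φ (S N)) (involutive (∈-S⇒Perm τ∈))
                  (∈-map⁺ φ (Perm⇒∈-S (preserves (∈-S⇒Perm τ∈))))

-- Inverse permutations

-- pos σ v is 1-indexed, and junk when v does not occur in σ
pos : List ℕ → ℕ → ℕ
pos []      v = 0
pos (x ∷ σ) v with x ≟ v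
... | yes _ = 1
... | no  _ = suc (pos σ v)

pos-spec : (σ : List ℕ) → ∀ {v} → v ∈ σ → InRange (length σ) (pos σ v) × at σ (pos σ v) ≡ v
pos-spec (x ∷ σ) {v} v∈ with x ≟ v
pos-spec (x ∷ σ) v∈          | yes x≡v = (s≤s z≤n , s≤s z≤n) , x≡v
pos-spec (x ∷ σ) (here refl) | no x≢v  = contradiction refl x≢v
pos-spec (x ∷ σ) {v} (there v∈)  | no x≢v with pos σ v | pos-spec σ v∈
... | suc i | (_ , le) , eq = (s≤s z≤n , s≤s le) , eq

inv : ℕ → List ℕ → List ℕ
inv N σ = map (pos σ) [1‥ N ]

module Inverse {N} {σ} (s : Perm N σ) where
  open Perm s

  inv-range : ∀ {v} → InRange N v → InRange N (at (inv N σ) v)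
  inv-range r rewrite at-map-[1‥] (pos σ) r =
    subst (λ n → InRange n _) len (proj₁ (pos-spec σ (surj r)))

  at-inv : ∀ {v} → InRange N v → at σ (at (inv N σ) v) ≡ v
  at-inv r rewrite at-map-[1‥] (pos σ) r = proj₂ (pos-spec σ (surj r))

  inv-at : ∀ {i} → InRange N i → at (inv N σ) (at σ i) ≡ i
  inv-at r = inj (inv-range (bounded r)) r (at-inv (bounded r))

  inv-Perm : Perm N (inv N σ)
  inv-Perm = record
    { len     = trans (length-map (pos σ) [1‥ N ]) (length-[1‥] N)
    ; bounded = inv-range
    ; inj     = λ r r′ eq → trans (sym (at-inv r)) (trans (cong (at σ) eq) (at-inv r′))
    }

open Inverse

inv-Involution : Involution N (inv N)
inv-Involution = record
  { preserves  = inv-Perm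
  ; involutive = λ s → let s′ = inv-Perm s in Perm-ext (inv-Perm s′) s λ r →
      Perm.inj s′ (inv-range s′ r) (Perm.bounded s r)
        (trans (at-inv s′ r) (sym (inv-at s r)))
  }

-- Distributions of column statistics

Family : Set₁
Family = List ℕ → ℕ → Set

Decides : Family → Set
Decides P = ∀ σ → Decidable (P σ)

-- Shaped like `coeff`, with any decidable property of columns in place of having a match;
-- `coeff≡distribution` connects the two.
distribution : ℕ → {P : Family} → Decides P → ℕ → ℕ
distribution N P? k = countᵇ (λ σ → countᵇ (λ j → ⌊ P? σ j ⌋) [1‥ N ] ≡ᵇ k) (S N)

⌊⌋-cong : {P Q : Set} (P? : Dec P) (Q? : Dec Q) → P ⇔ Q → ⌊ P? ⌋ ≡ ⌊ Q? ⌋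
⌊⌋-cong P? Q? eq = T-⇔⇒≡ (fromWitness ∘ to eq ∘ toWitness)
                         (fromWitness ∘ from eq ∘ toWitness)

distribution-cong : {P Q : Family} (P? : Decides P) (Q? : Decides Q) →
  (∀ {σ} → Perm N σ → ∀ {j} → InRange N j → P σ j ⇔ Q σ j) →
  ∀ k → distribution N P? k ≡ distribution N Q? k
distribution-cong {N} P? Q? eq k = countᵇ-cong (S N) λ {σ} σ∈ → cong (_≡ᵇ k)
  (countᵇ-cong [1‥ N ] λ {j} j∈ → ⌊⌋-cong (P? σ j) (Q? σ j) (eq (∈-S⇒Perm σ∈) (∈-[1‥]⁻ j∈)))

distribution-Involution : {P Q : Family} (P? : Decides P) (Q? : Decides Q)
  {φ : List ℕ → List ℕ} → Involution N φ →
  (∀ {σ} → Perm N σ → ∀ {j} → InRange N j → P σ j ⇔ Q (φ σ) j) →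
  ∀ k → distribution N P? k ≡ distribution N Q? k
distribution-Involution P? Q? {φ} I eq k =
  trans (distribution-cong P? (λ σ → Q? (φ σ)) eq k) (countᵇ-Involution I _)

-- Transpositions of values

transpose : ℕ → ℕ → ℕ → ℕ
transpose a b x with x ≟ a
... | yes _ = b
... | no  _ with x ≟ b
...   | yes _ = a
...   | no  _ = x

module _ (a b : ℕ) where
  transpose-left : transpose a b a ≡ b
  transpose-left with a ≟ a
  ... | yes _ = refl
  ... | no ne = contradiction refl ne

  transpose-right : transpose a b b ≡ a
  transpose-right with b ≟ a
  ... | yes b≡a = b≡a
  ... | no _ with b ≟ b
  ...   | yes _ = refl
  ...   | no ne = contradiction refl ne

  transpose-other : ∀ {x} → x ≢ a → x ≢ b → transpose a b x ≡ x
  transpose-other {x} x≢a x≢b with x ≟ a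
  ... | yes x≡a = contradiction x≡a x≢a
  ... | no _ with x ≟ b
  ...   | yes x≡b = contradiction x≡b x≢b
  ...   | no _ = refl

  data View : ℕ → Set where
    left  : ∀ {x} → x ≡ a → View x
    right : ∀ {x} → x ≡ b → View x
    other : ∀ {x} → x ≢ a → x ≢ b → View x

  view : ∀ x → View x
  view x with x ≟ a | x ≟ b
  ... | yes x≡a | _       = left x≡a
  ... | no _    | yes x≡b = right x≡b
  ... | no x≢a  | no x≢b  = other x≢a x≢b

  transpose-involutive : ∀ x → transpose a b (transpose a b x) ≡ x
  transpose-involutive x with view x
  ... | left refl  = trans (cong (transpose a b) transpose-left) transpose-right
  ... | right refl = trans (cong (transpose a b) transpose-right) transpose-left
  ... | other p q = trans (cong (transpose a b) (transpose-other p q)) (transpose-other p q)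

  swapValues : List ℕ → List ℕ
  swapValues = map (transpose a b)

  swapValues-involutive : ∀ σ → swapValues (swapValues σ) ≡ σ
  swapValues-involutive σ =
    trans (sym (map-∘ σ)) (trans (map-cong transpose-involutive σ) (map-id σ))

  module _ (s : Perm N σ) where
    at-swapValues : ∀ {i} → InRange N i → at (swapValues σ) i ≡ transpose a b (at σ i)
    at-swapValues r = at-map (transpose a b) σ (subst (λ n → InRange n _) (sym (Perm.len s)) r)

    swapValues-Perm : InRange N a → InRange N b → Perm N (swapValues σ)
    swapValues-Perm ra rb = record
      { len     = trans (length-map (transpose a b) σ) len
      ; bounded = λ r → subst (InRange N) (sym (at-swapValues r)) (transpose-range (bounded r))
      ; inj     = λ {i} {j} r r′ eq → inj r r′ (begin
          at σ i                                 ≡⟨ transpose-involutive (at σ i) ⟨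
          transpose a b (transpose a b (at σ i)) ≡⟨ cong (transpose a b) (at-swapValues r) ⟨
          transpose a b (at (swapValues σ) i)    ≡⟨ cong (transpose a b) eq ⟩
          transpose a b (at (swapValues σ) j)    ≡⟨ cong (transpose a b) (at-swapValues r′) ⟩
          transpose a b (transpose a b (at σ j)) ≡⟨ transpose-involutive (at σ j) ⟩
          at σ j                                 ∎)
      }
      where
      open Perm s
      open ≡-Reasoning
      transpose-range : ∀ {x} → InRange N x → InRange N (transpose a b x)
      transpose-range {x} r with view x
      ... | left refl  = subst (InRange N) (sym transpose-left) rb
      ... | right refl = subst (InRange N) (sym transpose-right) ra
      ... | other p q = subst (InRange N) (sym (transpose-other p q)) r

-- Abstract regions and bounded search

record Region (N : ℕ) : Set₁ where
  field
    C        : List ℕ → ℕ → ℕ → Set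
    C?       : ∀ σ x y → Dec (C σ x y)
    antitone : ∀ {x x′ y y′} → x′ ≤ x → y′ ≤ y → C σ x y → C σ x′ y′
    -- The premise says that both permutations have the same points strictly to the right of `x` and
    -- above `y`. The disjunction makes it symmetric in `σ` and `σ′`, and in this form it carries
    -- over to inverses.
    local    : ∀ {x y} → Perm N σ → Perm N σ′ →
               (∀ {i} → x < i → i ≤ N → y < at σ i ⊎ y < at σ′ i → at σ i ≡ at σ′ i) →
               C σ x y → C σ′ x y

∃Before : ℕ → (ℕ → Set) → Set
∃Before t P = ∃ λ i → i < t × 1 ≤ i × P i

∃Before? : ∀ {P} t → Decidable P → Dec (∃Before t P)
∃Before? t P? = anyUpTo? (λ i → 1 ≤? i ×-dec P? i) t

-- The predecessor of `v` in the set `P`.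
Maximum : (ℕ → Set) → ℕ → ℕ → Set
Maximum P v r = r < v × P r × (∀ {q} → q < v → P q → q ≤ r)

maximum-exists : {P : ℕ → Set} → Decidable P → ∀ {v q} → q < v → P q → ∃ (Maximum P v)
maximum-exists P? {suc v} {q} (s≤s q≤v) pq with P? v
... | yes p = v , ≤-refl , p , λ { (s≤s le) _ → le }
... | no ¬p with r , r<v , p , max ← maximum-exists P? (≤∧≢⇒< q≤v λ { refl → ¬p pq }) pq
    = r , m<n⇒m<1+n r<v , p , λ { (s≤s le) pq → max (≤∧≢⇒< le λ { refl → ¬p pq }) pq }

maximum? : {P : ℕ → Set} → Decidable P → ∀ v → Dec (∃ (Maximum P v))
maximum? P? v = map′ (λ { (_ , q<v , pq) → maximum-exists P? q<v pq })
                     (λ { (r , r<v , pr , _) → r , r<v , pr }) (anyUpTo? P? v)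

-- The two rules and their interpolation

module Statistics {N : ℕ} (R : Region N) where
  open Region R

  -- Both rules compare the entry of column `j` with the region values occurring in columns ≤ `j`.
  -- By antitonicity the smaller of two compared values lies in the region as soon as the larger
  -- does, so the condition is put on the larger one.
  NotMin NotMax : Family
  NotMin σ j = C σ j (at σ j) × ∃Before j (λ i → at σ i < at σ j)
  NotMax σ j = ∃Before j (λ i → at σ j < at σ i × C σ j (at σ i))

  NotMin? : Decides NotMin
  NotMin? σ j = C? σ j (at σ j) ×-dec ∃Before? j (λ i → at σ i <? at σ j)

  NotMax? : Decides NotMax
  NotMax? σ j = ∃Before? j (λ i → at σ j <? at σ i ×-dec C? σ j (at σ i))

  -- Among the values in columns ≤ j that lie in the region at column j, the entry of column j is
  -- not the largest one that is ≤ v (not the smallest one, if none is ≤ v).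
  NotChosen : ℕ → Family
  NotChosen v σ j = C σ j (at σ j) ×
    ( (at σ j ≤ v × ∃Before j (λ i → at σ j < at σ i × at σ i ≤ v × C σ j (at σ i)))
    ⊎ (v < at σ j × ∃Before j (λ i → at σ i < at σ j)))

  NotChosen? : ∀ v → Decides (NotChosen v)
  NotChosen? v σ j = C? σ j (at σ j) ×-dec
    ( (at σ j ≤? v ×-dec ∃Before? j (λ i → at σ j <? at σ i ×-dec at σ i ≤? v ×-dec C? σ j (at σ i)))
    ⊎-dec (v <? at σ j ×-dec ∃Before? j (λ i → at σ i <? at σ j)))

  -- As `v` runs from `N` down to 0, column `t` passes from the rule `NotMax` of the columns on its
  -- right to the rule `NotMin` of those on its left.
  Mixed : ℕ → ℕ → Family
  Mixed t v σ j = (j < t × NotMin σ j) ⊎ (j ≡ t × NotChosen v σ j) ⊎ (t < j × NotMax σ j)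

  Mixed? : ∀ t v → Decides (Mixed t v)
  Mixed? t v σ j = (j <? t ×-dec NotMin? σ j) ⊎-dec (j ≟ t ×-dec NotChosen? v σ j)
                   ⊎-dec (t <? j ×-dec NotMax? σ j)

  -- Lowering the threshold at one column by one

  module Step (t : ℕ) (t-range : InRange N t) (u : ℕ) where
    v : ℕ
    v = suc u

    -- Building `σ` from right to left, these are the values still free when column `t` is filled.
    Prefix : List ℕ → ℕ → Set
    Prefix σ x = ∃Before (suc t) (λ i → at σ i ≡ x)

    Prefix? : Decides Prefix
    Prefix? σ x = ∃Before? (suc t) (λ i → at σ i ≟ x)

    Prefix-self : ∀ σ → Prefix σ (at σ t)
    Prefix-self σ = t , ≤-refl , proj₁ t-range , refl

    -- For permutations this is disagreement of the thresholds `v` and `u` at column `t`: the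
    -- forbidden value is `v` for the first and its predecessor `r` for the second, and column `t`
    -- holds one of the two.
    Swappable : List ℕ → ℕ → Set
    Swappable σ r = Maximum (Prefix σ) v r × Prefix σ v × C σ t v × (at σ t ≡ v ⊎ at σ t ≡ r)

    Swappable-unique : ∀ {r r′} → Swappable σ r → Swappable σ r′ → r ≡ r′
    Swappable-unique ((r<v , p , max) , _) ((r′<v , p′ , max′) , _) = ≤-antisym (max′ r<v p) (max r′<v p′)

    swappable? : ∀ σ → Dec (∃ (Swappable σ))
    swappable? σ with maximum? (Prefix? σ) v
    ... | no ¬m = no λ { (r , m , _) → ¬m (r , m) }
    -- A predecessor is unique, so the other conditions are tested at this `r` alone.
    ... | yes (r , m@(r<v , p , max)) = map′ (λ w → r , m , w)
          (λ { (r′ , (r′<v , p′ , max′) , w) → subst (λ r → Prefix σ v × C σ t v × (at σ t ≡ v ⊎ at σ t ≡ r))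
                 (≤-antisym (max r′<v p′) (max′ r<v p)) w })
          (Prefix? σ v ×-dec C? σ t v ×-dec (at σ t ≟ v ⊎-dec at σ t ≟ r))

    exchange : List ℕ → List ℕ
    exchange σ with swappable? σ
    ... | yes (r , _) = swapValues v r σ
    ... | no _        = σ

    ≤t⇒range : ∀ {i} → i < suc t → 1 ≤ i → InRange N i
    ≤t⇒range (s≤s i≤t) 1≤i = 1≤i , ≤-trans i≤t (proj₂ t-range)

    <t⇒range : ∀ {i} → i < t → 1 ≤ i → InRange N i
    <t⇒range i<t = ≤t⇒range (m<n⇒m<1+n i<t)

    Prefix⇒range : Perm N σ → ∀ {x} → Prefix σ x → InRange N x
    Prefix⇒range s (i , i≤t , 1≤i , refl) = Perm.bounded s (≤t⇒range i≤t 1≤i)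

    Prefix⇒before : ∀ σ {x} → at σ t ≢ x → Prefix σ x → ∃Before t (λ i → at σ i ≡ x)
    Prefix⇒before σ ne (i , s≤s i≤t , 1≤i , eq) = i , ≤∧≢⇒< i≤t (λ { refl → ne eq }) , 1≤i , eq

    module Swapped {σ} (s : Perm N σ) {r} (w : Swappable σ r) where
      r<v    = proj₁ (proj₁ w)
      pre-r  = proj₁ (proj₂ (proj₁ w))
      pre-v  = proj₁ (proj₂ w)
      in-v   = proj₁ (proj₂ (proj₂ w))
      at-t   = proj₂ (proj₂ (proj₂ w))

      between : ∀ {q} → q < v → Prefix σ q → q ≤ r
      between = proj₂ (proj₂ (proj₁ w))

      τ : List ℕ
      τ = swapValues v r σ

      τ-Perm : Perm N τ
      τ-Perm = swapValues-Perm v r s (Prefix⇒range s pre-v) (Prefix⇒range s pre-r)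

      at-τ : ∀ {i} → InRange N i → at τ i ≡ transpose v r (at σ i)
      at-τ = at-swapValues v r s

      τ-left : ∀ {i} → InRange N i → at σ i ≡ v → at τ i ≡ r
      τ-left ri eq = trans (at-τ ri) (trans (cong (transpose v r) eq) (transpose-left v r))

      τ-right : ∀ {i} → InRange N i → at σ i ≡ r → at τ i ≡ v
      τ-right ri eq = trans (at-τ ri) (trans (cong (transpose v r) eq) (transpose-right v r))

      τ-other : ∀ {i} → InRange N i → at σ i ≢ v → at σ i ≢ r → at τ i ≡ at σ i
      τ-other ri p q = trans (at-τ ri) (transpose-other v r p q)

      suffix≢ : ∀ {i x} → t < i → i ≤ N → Prefix σ x → at σ i ≢ x
      suffix≢ {i} t<i i≤N (j , s≤s j≤t , 1≤j , eq) eq′ = <⇒≢ (≤-<-trans j≤t t<i)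
        (Perm.inj s (≤t⇒range (s≤s j≤t) 1≤j) (≤-trans (s≤s z≤n) t<i , i≤N) (trans eq (sym eq′)))

      -- Both exchanged values sit in columns ≤ `t`.
      suffix-same : ∀ {i} → t < i → i ≤ N → at τ i ≡ at σ i
      suffix-same t<i i≤N = τ-other (≤-trans (s≤s z≤n) t<i , i≤N)
        (suffix≢ t<i i≤N pre-v) (suffix≢ t<i i≤N pre-r)

      Prefix-τ⁺ : ∀ {x} → Prefix σ x → Prefix τ x
      Prefix-τ⁺ {x} p with view v r x
      Prefix-τ⁺ _ | left refl  = let i , i≤ , 1≤ , eq = pre-r in i , i≤ , 1≤ , τ-right (≤t⇒range i≤ 1≤) eq
      Prefix-τ⁺ _ | right refl = let i , i≤ , 1≤ , eq = pre-v in i , i≤ , 1≤ , τ-left (≤t⇒range i≤ 1≤) eq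
      Prefix-τ⁺ (i , i≤ , 1≤ , refl) | other p q = i , i≤ , 1≤ , τ-other (≤t⇒range i≤ 1≤) p q

      Prefix-τ⁻ : ∀ {x} → Prefix τ x → Prefix σ x
      Prefix-τ⁻ {x} p with view v r x
      Prefix-τ⁻ _ | left refl  = pre-v
      Prefix-τ⁻ _ | right refl = pre-r
      Prefix-τ⁻ {x} (i , i≤ , 1≤ , eq) | other p q with view v r (at σ i)
      ... | left  eq′   = contradiction (trans (sym eq) (τ-left (≤t⇒range i≤ 1≤) eq′)) q
      ... | right eq′   = contradiction (trans (sym eq) (τ-right (≤t⇒range i≤ 1≤) eq′)) p
      ... | other p′ q′ = i , i≤ , 1≤ , trans (sym (τ-other (≤t⇒range i≤ 1≤) p′ q′)) eq

      -- The region at column `t` is determined by the columns to its right, which the swap leaves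
      -- alone.
      in-v-τ : C τ t v
      in-v-τ = local s τ-Perm (λ t<i i≤N _ → sym (suffix-same t<i i≤N)) in-v

      at-t-τ : at τ t ≡ v ⊎ at τ t ≡ r
      at-t-τ = Sum.swap (Sum.map (τ-left t-range) (τ-right t-range) at-t)

      τ-Swappable : Swappable τ r
      τ-Swappable = (r<v , Prefix-τ⁺ pre-r , λ lt p → between lt (Prefix-τ⁻ p)) ,
                    Prefix-τ⁺ pre-v , in-v-τ , at-t-τ

      -- Left of column t only one of the adjacent values r and v occurs.
      before-mono : ∀ {i j} → i < t → 1 ≤ i → j < t → 1 ≤ j → at σ i < at σ j → at τ i < at τ j
      before-mono {i} {j} i<t 1≤i j<t 1≤j lt with view v r (at σ i) | view v r (at σ j)
      ... | left p | left q = contradiction (subst₂ _<_ p q lt) (<-irrefl refl)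
      ... | left p | right q = contradiction (subst₂ _<_ p q lt) (<-asym r<v)
      ... | right p | right q = contradiction (subst₂ _<_ p q lt) (<-irrefl refl)
      ... | other p p′ | other q q′ =
        subst₂ _<_ (sym (τ-other (<t⇒range i<t 1≤i) p p′)) (sym (τ-other (<t⇒range j<t 1≤j) q q′)) lt
      ... | left p | other q q′ =
        subst₂ _<_ (sym (τ-left (<t⇒range i<t 1≤i) p)) (sym (τ-other (<t⇒range j<t 1≤j) q q′))
          (<-trans r<v (subst (_< at σ j) p lt))
      ... | other p p′ | right q =
        subst₂ _<_ (sym (τ-other (<t⇒range i<t 1≤i) p p′)) (sym (τ-right (<t⇒range j<t 1≤j) q))
          (<-trans (subst (at σ i <_) q lt) r<v)
      ... | right p | other q q′ =
        subst₂ _<_ (sym (τ-right (<t⇒range i<t 1≤i) p)) (sym (τ-other (<t⇒range j<t 1≤j) q q′))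
          (≤∧≢⇒< (≮⇒≥ λ σj<v → <⇒≱ (subst (_< at σ j) p lt)
             (between σj<v (j , m<n⇒m<1+n j<t , 1≤j , refl))) (q ∘ sym))
      ... | other p p′ | left q =
        subst₂ _<_ (sym (τ-other (<t⇒range i<t 1≤i) p p′)) (sym (τ-left (<t⇒range j<t 1≤j) q))
          (≤∧≢⇒< (between (subst (at σ i <_) q lt) (i , m<n⇒m<1+n i<t , 1≤i , refl)) p′)
      ... | right p | left q with at-t
      ...   | inj₁ at-t≡v = contradiction
                (Perm.inj s (<t⇒range j<t 1≤j) t-range (trans q (sym at-t≡v))) (<⇒≢ j<t)
      ...   | inj₂ at-t≡r = contradiction
                (Perm.inj s (<t⇒range i<t 1≤i) t-range (trans p (sym at-t≡r))) (<⇒≢ i<t)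

      -- Up to height v the region is full at all columns ≤ t; above v nothing moves.
      in-region : ∀ {j} → j < t → 1 ≤ j → C σ j (at σ j) → C τ j (at τ j)
      in-region {j} j<t 1≤j c with at τ j ≤? v
      ... | yes le = antitone (<⇒≤ j<t) le in-v-τ
      ... | no nle = subst (C τ j) (sym τj≡) (local s τ-Perm agree c)
        where
        rj = <t⇒range j<t 1≤j
        v<τj = ≰⇒> nle
        τj≡ : at τ j ≡ at σ j
        τj≡ with view v r (at σ j)
        ... | left  p = contradiction (subst (v <_) (τ-left rj p) v<τj) (<-asym r<v)
        ... | right p = contradiction (subst (v <_) (τ-right rj p) v<τj) (<-irrefl refl)
        ... | other p q = τ-other rj p q
        v<σj : v < at σ j
        v<σj = subst (v <_) τj≡ v<τj
        agree : ∀ {i} → j < i → i ≤ N → at σ j < at σ i ⊎ at σ j < at τ i → at σ i ≡ at τ i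
        agree {i} j<i i≤N big with view v r (at σ i) | big
        ... | other p q | _ = sym (τ-other (≤-trans (s≤s z≤n) j<i , i≤N) p q)
        ... | left p | inj₁ lt = contradiction (<-trans v<σj (subst (at σ j <_) p lt)) (<-irrefl refl)
        ... | left p | inj₂ lt = contradiction (<-trans v<σj (subst (at σ j <_)
                                   (τ-left (≤-trans (s≤s z≤n) j<i , i≤N) p) lt)) (<-asym r<v)
        ... | right p | inj₁ lt = contradiction (<-trans v<σj (subst (at σ j <_) p lt)) (<-asym r<v)
        ... | right p | inj₂ lt = contradiction (<-trans v<σj (subst (at σ j <_)
                                    (τ-right (≤-trans (s≤s z≤n) j<i , i≤N) p) lt)) (<-irrefl refl)

      NotMin-τ : ∀ {j} → j < t → 1 ≤ j → NotMin σ j → NotMin τ j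
      NotMin-τ j<t 1≤j (c , i , i<j , 1≤i , lt) =
        in-region j<t 1≤j c , i , i<j , 1≤i , before-mono (<-trans i<j j<t) 1≤i j<t 1≤j lt

      -- The larger entry `at σ i` may move, but only within columns ≤ `t`, so it still occurs
      -- before column `j`.
      NotMax-τ : ∀ {j} → t < j → j ≤ N → NotMax σ j → NotMax τ j
      NotMax-τ {j} t<j j≤N (i , i<j , 1≤i , lt , c) =
        let i′ , i′<j , 1≤i′ , eq = occurs in
        i′ , i′<j , 1≤i′ , subst₂ _<_ (sym (suffix-same t<j j≤N)) (sym eq) lt ,
        subst (C τ j) (sym eq) (local s τ-Perm (λ j<k k≤N _ → sym (suffix-same (<-trans t<j j<k) k≤N)) c)
        where
        occurs : ∃Before j (λ i′ → at τ i′ ≡ at σ i)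
        occurs with i ≤? t
        ... | no i≰t = i , i<j , 1≤i , suffix-same (≰⇒> i≰t) (<⇒≤ (<-≤-trans i<j j≤N))
        ... | yes i≤t with i′ , s≤s i′≤t , 1≤i′ , eq ← Prefix-τ⁺ (i , s≤s i≤t , 1≤i , refl)
            = i′ , ≤-<-trans i′≤t t<j , 1≤i′ , eq

      -- If column `t` of `σ` holds `v`, then `v` is forbidden in `σ` and `r` in `τ`, and both sides
      -- fail; if it holds `r`, both sides hold. The converse is included because the way back
      -- starts from threshold `u` and is no instance of the way forth.
      NotChosen-τ : NotChosen v σ t ⇔ NotChosen u τ t
      NotChosen-τ with at-t
      ... | inj₁ at-t≡v = mk⇔
        (λ { (_ , inj₁ (_ , i , _ , _ , lt , le , _)) →
               contradiction (subst (_< v) at-t≡v (<-≤-trans lt le)) (<-irrefl refl)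
           ; (_ , inj₂ (lt , _)) → contradiction (subst (v <_) at-t≡v lt) (<-irrefl refl) })
        -- Such an entry would be a prefix value strictly between `r` and `v`.
        (λ { (_ , inj₁ (_ , i , i<t , 1≤i , lt , le , _)) →
               contradiction (subst (_< at τ i) (τ-left t-range at-t≡v) lt)
                 (≤⇒≯ (between (s≤s le) (Prefix-τ⁻ (i , m<n⇒m<1+n i<t , 1≤i , refl))))
           ; (_ , inj₂ (lt , _)) →
               contradiction r<v (≤⇒≯ (subst (u <_) (τ-left t-range at-t≡v) lt)) })
      ... | inj₂ at-t≡r = mk⇔
        -- Column `t` holds one of the two values, so the other occurs before it: `r` in `τ`, and
        -- `v` in `σ`.
        (λ _ → subst (C τ t) (sym τt≡v) in-v-τ ,
               inj₂ (≤-reflexive (sym τt≡v) ,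
                 let i , i<t , 1≤i , eq = Prefix⇒before τ (λ eq → <⇒≢ r<v (trans (sym eq) τt≡v)) (Prefix-τ⁺ pre-r)
                 in i , i<t , 1≤i , subst₂ _<_ (sym eq) (sym τt≡v) r<v))
        (λ _ → antitone ≤-refl (<⇒≤ σt<v) in-v ,
               inj₁ (<⇒≤ σt<v ,
                 let i , i<t , 1≤i , eq = Prefix⇒before σ (<⇒≢ σt<v) pre-v
                 in i , i<t , 1≤i , subst (at σ t <_) (sym eq) σt<v , ≤-reflexive eq ,
                    subst (C σ t) (sym eq) in-v))
        where
        τt≡v : at τ t ≡ v
        τt≡v = τ-right t-range at-t≡r
        σt<v : at σ t < v
        σt<v = subst (_< v) (sym at-t≡r) r<v

      Mixed-τ : ∀ {j} → InRange N j → Mixed t v σ j → Mixed t u τ j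
      Mixed-τ (1≤j , j≤N) (inj₁ (j<t , m))         = inj₁ (j<t , NotMin-τ j<t 1≤j m)
      Mixed-τ (1≤j , j≤N) (inj₂ (inj₁ (refl , m))) = inj₂ (inj₁ (refl , to NotChosen-τ m))
      Mixed-τ (1≤j , j≤N) (inj₂ (inj₂ (t<j , m)))  = inj₂ (inj₂ (t<j , NotMax-τ t<j j≤N m))

    module _ {σ} (s : Perm N σ) {r} (w : Swappable σ r) where
      open Swapped s w
      private module Back = Swapped τ-Perm τ-Swappable

      -- Off column `t` the rules do not involve the threshold, so the way back is the way forth for
      -- `τ`, whose swap is `σ` again.
      Mixed-τ⁻ : ∀ {j} → InRange N j → Mixed t u τ j → Mixed t v σ j
      Mixed-τ⁻ {j} (1≤j , j≤N) (inj₁ (j<t , m)) =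
        inj₁ (j<t , subst (λ ρ → NotMin ρ j) (swapValues-involutive v r σ) (Back.NotMin-τ j<t 1≤j m))
      Mixed-τ⁻ _ (inj₂ (inj₁ (refl , m))) = inj₂ (inj₁ (refl , from NotChosen-τ m))
      Mixed-τ⁻ {j} (1≤j , j≤N) (inj₂ (inj₂ (t<j , m))) =
        inj₂ (inj₂ (t<j , subst (λ ρ → NotMax ρ j) (swapValues-involutive v r σ) (Back.NotMax-τ t<j j≤N m)))

    -- The forbidden value changes only if `v` is free, in the region, and has a free predecessor.
    -- Without a swap, column `t` then holds neither of these two values and is treated alike by
    -- both thresholds.
    NotChosen-fixed : ∀ {σ} → ¬ ∃ (Swappable σ) → NotChosen v σ t ⇔ NotChosen u σ t
    NotChosen-fixed {σ} ¬w = mk⇔ down up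
      where
      down : NotChosen v σ t → NotChosen u σ t
      down (c , inj₂ (lt , e)) = c , inj₂ (<⇒≤ lt , e)
      down (c , inj₁ (le , i , i<t , 1≤i , lt , σi≤v , ci)) with m≤n⇒m<n∨m≡n σi≤v
      ... | inj₁ (s≤s σi≤u) = c , inj₁ (≤-trans (<⇒≤ lt) σi≤u , i , i<t , 1≤i , lt , σi≤u , ci)
      -- Only the witness `v` is lost with the lower threshold. Its predecessor `r` replaces it,
      -- unless column `t` holds `r` itself; then a swap would be possible.
      ... | inj₂ σi≡v
        with σt<v ← subst (at σ t <_) σi≡v lt
        with r , m@(r<v , pre-r , max) ← maximum-exists (Prefix? σ) σt<v (Prefix-self σ)
        with at σ t ≟ r
      ...   | yes σt≡r = contradiction
                (r , m , (i , m<n⇒m<1+n i<t , 1≤i , σi≡v) , subst (C σ t) σi≡v ci , inj₂ σt≡r) ¬w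
      ...   | no σt≢r =
                let k , k<t , 1≤k , eq = Prefix⇒before σ σt≢r pre-r in
                c , inj₁ (≤-pred σt<v , k , k<t , 1≤k ,
                  subst (at σ t <_) (sym eq) (≤∧≢⇒< (max σt<v (Prefix-self σ)) σt≢r) ,
                  subst (_≤ u) (sym eq) (≤-pred r<v) ,
                  subst (C σ t) (sym eq) (antitone ≤-refl (<⇒≤ r<v) (subst (C σ t) σi≡v ci)))
      up : NotChosen u σ t → NotChosen v σ t
      up (c , inj₁ (le , i , i<t , 1≤i , lt , σi≤u , ci)) =
        c , inj₁ (m≤n⇒m≤1+n le , i , i<t , 1≤i , lt , m≤n⇒m≤1+n σi≤u , ci)
      up (c , inj₂ (lt , i , i<t , 1≤i , σi<σt)) with m≤n⇒m<n∨m≡n lt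
      ... | inj₁ v<σt = c , inj₂ (v<σt , i , i<t , 1≤i , σi<σt)
      -- Column `t` holds `v`, and the smaller entry gives `v` a predecessor, so a swap would be
      -- possible.
      ... | inj₂ v≡σt =
        let r , m = maximum-exists (Prefix? σ) (subst (at σ i <_) (sym v≡σt) σi<σt)
                      (i , m<n⇒m<1+n i<t , 1≤i , refl) in
        contradiction (r , m , (t , ≤-refl , proj₁ t-range , sym v≡σt) ,
          subst (C σ t) (sym v≡σt) c , inj₁ (sym v≡σt)) ¬w

    -- After a swap the same `r` is again the predecessor of `v`, so the second application swaps
    -- back.
    exchange-Involution : Involution N exchange
    exchange-Involution = record { preserves = preserves ; involutive = involutive }
      where
      preserves : ∀ {σ} → Perm N σ → Perm N (exchange σ)
      preserves {σ} s with swappable? σ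
      ... | yes (r , w) = Swapped.τ-Perm s w
      ... | no _        = s
      exchange-no : ∀ {σ} → ¬ ∃ (Swappable σ) → exchange σ ≡ σ
      exchange-no {σ} ¬w with swappable? σ
      ... | yes w = contradiction w ¬w
      ... | no _  = refl
      exchange-yes : ∀ {σ r} → Swappable σ r → exchange σ ≡ swapValues v r σ
      exchange-yes {σ} {r} w with swappable? σ
      ... | yes (r′ , w′) = cong (λ r → swapValues v r σ) (Swappable-unique w′ w)
      ... | no ¬w         = contradiction (r , w) ¬w
      involutive : ∀ {σ} → Perm N σ → exchange (exchange σ) ≡ σ
      involutive {σ} s with swappable? σ
      ... | yes (r , w) = trans (exchange-yes (Swapped.τ-Swappable s w)) (swapValues-involutive v r σ)
      ... | no ¬w       = exchange-no ¬w

    Mixed-exchange : ∀ {σ} → Perm N σ → ∀ {j} → InRange N j → Mixed t v σ j ⇔ Mixed t u (exchange σ) j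
    Mixed-exchange {σ} s rj with swappable? σ
    ... | yes (r , w) = mk⇔ (Swapped.Mixed-τ s w rj) (Mixed-τ⁻ s w rj)
    ... | no ¬w       = mk⇔
      (Sum.map₂ (Sum.map₁ λ { (refl , m) → refl , to (NotChosen-fixed ¬w) m }))
      (Sum.map₂ (Sum.map₁ λ { (refl , m) → refl , from (NotChosen-fixed ¬w) m }))

    distribution-step : ∀ k → distribution N (Mixed? t v) k ≡ distribution N (Mixed? t u) k
    distribution-step = distribution-Involution (Mixed? t v) (Mixed? t u) exchange-Involution Mixed-exchange

  -- From one column to all columns

  distribution-column : ∀ {t} → InRange N t → ∀ v k →
                        distribution N (Mixed? t v) k ≡ distribution N (Mixed? t 0) k
  distribution-column tr zero    k = refl
  distribution-column tr (suc u) k =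
    trans (Step.distribution-step _ tr u k) (distribution-column tr u k)

  -- Entries are at least 1, so at threshold 0 the smallest value is the forbidden one.
  NotChosen-0 : Perm N σ → ∀ {j} → InRange N j → NotChosen 0 σ j ⇔ NotMin σ j
  NotChosen-0 s rj = mk⇔
    (λ { (c , inj₁ (le , _)) → contradiction (proj₁ (Perm.bounded s rj)) (≤⇒≯ le)
       ; (c , inj₂ (_ , e)) → c , e })
    (λ { (c , e) → c , inj₂ (proj₁ (Perm.bounded s rj) , e) })

  -- Entries are at most `N`, so at threshold `N` the largest region value is the forbidden one.
  NotChosen-N : Perm N σ → ∀ {j} → InRange N j → NotChosen N σ j ⇔ NotMax σ j
  NotChosen-N s {j} rj@(_ , j≤N) = mk⇔
    (λ { (c , inj₁ (_ , i , i<j , 1≤i , lt , _ , ci)) → i , i<j , 1≤i , lt , ci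
       ; (c , inj₂ (lt , _)) → contradiction (proj₂ (Perm.bounded s rj)) (<⇒≱ lt) })
    (λ { (i , i<j , 1≤i , lt , ci) → antitone ≤-refl (<⇒≤ lt) ci ,
           inj₁ (proj₂ (Perm.bounded s rj) , i , i<j , 1≤i , lt ,
                 proj₂ (Perm.bounded s (1≤i , <⇒≤ (<-≤-trans i<j j≤N))) , ci) })

  -- The meeting point of the chains of neighbouring columns: on permutations, `Mixed t 0` and
  -- `Mixed (suc t) N` both amount to it.
  Split : ℕ → Family
  Split t σ j = (j ≤ t × NotMin σ j) ⊎ (t < j × NotMax σ j)

  Split? : ∀ t → Decides (Split t)
  Split? t σ j = (j ≤? t ×-dec NotMin? σ j) ⊎-dec (t <? j ×-dec NotMax? σ j)

  Mixed-0 : ∀ {t} → Perm N σ → ∀ {j} → InRange N j → Mixed t 0 σ j ⇔ Split t σ j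
  Mixed-0 s rj = mk⇔
    (λ { (inj₁ (j<t , m)) → inj₁ (<⇒≤ j<t , m)
       ; (inj₂ (inj₁ (refl , m))) → inj₁ (≤-refl , to (NotChosen-0 s rj) m)
       ; (inj₂ (inj₂ m)) → inj₂ m })
    (λ { (inj₁ (j≤t , m)) → Sum.map (_, m) (λ eq → inj₁ (eq , from (NotChosen-0 s rj) m))
                              (m≤n⇒m<n∨m≡n j≤t)
       ; (inj₂ m) → inj₂ (inj₂ m) })

  Mixed-N : ∀ {t} → Perm N σ → ∀ {j} → InRange N j → Mixed (suc t) N σ j ⇔ Split t σ j
  Mixed-N s rj = mk⇔
    (λ { (inj₁ (s≤s j≤t , m)) → inj₁ (j≤t , m)
       ; (inj₂ (inj₁ (refl , m))) → inj₂ (≤-refl , to (NotChosen-N s rj) m)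
       ; (inj₂ (inj₂ (t<j , m))) → inj₂ (<⇒≤ t<j , m) })
    (λ { (inj₁ (j≤t , m)) → inj₁ (s≤s j≤t , m)
       ; (inj₂ (t<j , m)) → inj₂ (Sum.swap (Sum.map (_, m)
           (λ eq → sym eq , from (NotChosen-N s rj) m) (m≤n⇒m<n∨m≡n t<j))) })

  -- Each step turns column `suc t` from `NotMin` to `NotMax` by raising its threshold from 0 to
  -- `N`.
  distribution-Split : ∀ t → t ≤ N → ∀ k → distribution N (Split? t) k ≡ distribution N (Split? 0) k
  distribution-Split zero    le k = refl
  distribution-Split (suc t) le k = begin
    distribution N (Split? (suc t)) k    ≡⟨ distribution-cong (Mixed? (suc t) 0) (Split? (suc t)) Mixed-0 k ⟨
    distribution N (Mixed? (suc t) 0) k  ≡⟨ distribution-column (s≤s z≤n , le) N k ⟨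
    distribution N (Mixed? (suc t) N) k  ≡⟨ distribution-cong (Mixed? (suc t) N) (Split? t) Mixed-N k ⟩
    distribution N (Split? t) k          ≡⟨ distribution-Split t (<⇒≤ le) k ⟩
    distribution N (Split? 0) k          ∎
    where open ≡-Reasoning

  -- Columns run from 1 to `N`, so `Split N` is `NotMin` throughout and `Split 0` is `NotMax`
  -- throughout.
  NotMin~NotMax : ∀ k → distribution N NotMin? k ≡ distribution N NotMax? k
  NotMin~NotMax k = begin
    distribution N NotMin? k     ≡⟨ distribution-cong {N = N} NotMin? (Split? N) (λ _ rj → mk⇔
        (λ m → inj₁ (proj₂ rj , m))
        (λ { (inj₁ (_ , m)) → m ; (inj₂ (lt , _)) → contradiction (proj₂ rj) (<⇒≱ lt) })) k ⟩
    distribution N (Split? N) k  ≡⟨ distribution-Split N ≤-refl k ⟩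
    distribution N (Split? 0) k  ≡⟨ distribution-cong {N = N} NotMax? (Split? 0) (λ _ rj → mk⇔
        (λ m → inj₂ (proj₁ rj , m))
        (λ { (inj₁ (le , _)) → contradiction (proj₁ rj) (≤⇒≯ le) ; (inj₂ (_ , m)) → m })) k ⟨
    distribution N NotMax? k     ∎
    where open ≡-Reasoning

-- Subsequences as increasing index tuples

∈-subseqs⁻ : ∀ {xs I} → AllPairs _<_ xs → I ∈ subseqs xs → AllPairs _<_ I × All (_∈ xs) I
∈-subseqs⁻ {[]} [] (here refl) = [] , []
∈-subseqs⁻ {x ∷ xs} (x< ∷ ord) I∈ with ∈-++⁻ (map (x ∷_) (subseqs xs)) I∈
... | inj₂ I∈′ = let inc , al = ∈-subseqs⁻ ord I∈′ in inc , All.map there al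
... | inj₁ I∈′ with I′ , I′∈ , refl ← ∈-map⁻ (x ∷_) I∈′ =
  let inc , al = ∈-subseqs⁻ ord I′∈ in
  All.map (All.lookup x<) al ∷ inc , here refl ∷ All.map there al

∈-subseqs⁺ : ∀ {xs I} → AllPairs _<_ xs → AllPairs _<_ I → All (_∈ xs) I → I ∈ subseqs xs
∈-subseqs⁺ {[]} [] [] [] = here refl
∈-subseqs⁺ {[]} [] _ (() ∷ _)
∈-subseqs⁺ {x ∷ xs} (x< ∷ ord) [] [] = ∈-++⁺ʳ (map (x ∷_) (subseqs xs)) (∈-subseqs⁺ ord [] [])
∈-subseqs⁺ {x ∷ xs} {i ∷ I} (x< ∷ ord) (i< ∷ inc) (i∈ ∷ al) = go i∈
  where
  -- Entries after `i` exceed `x`, so they must come from `xs`.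
  tail∈ : x ≤ i → All (_∈ xs) I
  tail∈ x≤i = All.tabulate λ {j} j∈ → drop (All.lookup i< j∈) (All.lookup al j∈)
    where
    drop : ∀ {j} → i < j → j ∈ x ∷ xs → j ∈ xs
    drop i<j (here refl) = contradiction x≤i (<⇒≱ i<j)
    drop i<j (there j∈)  = j∈
  go : i ∈ x ∷ xs → i ∷ I ∈ subseqs (x ∷ xs)
  go (here refl) = ∈-++⁺ˡ (∈-map⁺ (x ∷_) (∈-subseqs⁺ ord inc (tail∈ ≤-refl)))
  go (there i∈′) = ∈-++⁺ʳ (map (x ∷_) (subseqs xs))
    (∈-subseqs⁺ ord (i< ∷ inc) (i∈′ ∷ tail∈ (<⇒≤ (All.lookup x< i∈′))))

[1‥]-increasing : ∀ N → AllPairs _<_ [1‥ N ]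
[1‥]-increasing N = AllPairs.applyUpTo⁺₁ (1 +_) N (λ i<j _ → s≤s i<j)

IndexTuple : ℕ → List ℕ → Set
IndexTuple N I = AllPairs _<_ I × All (InRange N) I

IndexTuple⇔∈ : ∀ {I} → I ∈ subseqs [1‥ N ] ⇔ IndexTuple N I
IndexTuple⇔∈ {N} = mk⇔
  (λ I∈ → let inc , al = ∈-subseqs⁻ ([1‥]-increasing N) I∈ in inc , All.map ∈-[1‥]⁻ al)
  (λ { (inc , al) → ∈-subseqs⁺ ([1‥]-increasing N) inc (All.map ∈-[1‥]⁺ al) })

-- Ranks and reduced words

-- `red w` unfolds to `map (λ a → suc (below a w)) w`, so ranks can be computed letter by letter.
below : ℕ → List ℕ → ℕ
below x w = countᵇ (λ y → y <ᵇ x) w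

below-< : ∀ {x y} w → y < x → below x (y ∷ w) ≡ suc (below x w)
below-< w y<x rewrite to T-≡ (<⇒<ᵇ y<x) = refl

below-≥ : ∀ {x y} w → x ≤ y → below x (y ∷ w) ≡ below x w
below-≥ {x} {y} w x≤y rewrite ¬-not {y <ᵇ x} (λ eq →
  ≤⇒≯ x≤y (<ᵇ⇒< y x (from T-≡ eq))) = refl

below≡0⇒ : ∀ {x} w → below x w ≡ 0 → All (x ≤_) w
below≡0⇒ []      eq = []
below≡0⇒ {x} (y ∷ w) eq with y <? x
... | yes y<x = contradiction (trans (sym (below-< w y<x)) eq) λ ()
... | no y≮x  = ≮⇒≥ y≮x ∷ below≡0⇒ w (trans (sym (below-≥ w (≮⇒≥ y≮x))) eq)

⇒below≡0 : ∀ {x w} → All (x ≤_) w → below x w ≡ 0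
⇒below≡0 []             = refl
⇒below≡0 {w = y ∷ w} (x≤y ∷ x≤w) = trans (below-≥ w x≤y) (⇒below≡0 x≤w)

below-swap : ∀ x a b w → below x (a ∷ b ∷ w) ≡ below x (b ∷ a ∷ w)
below-swap x a b w with a <ᵇ x | b <ᵇ x
... | true  | true  = refl
... | true  | false = refl
... | false | true  = refl
... | false | false = refl

below-above : ∀ {x a b} w → a < b → b < x → below x (a ∷ b ∷ w) ≡ suc (suc (below x w))
below-above w a<b b<x = trans (below-< (_ ∷ w) (<-trans a<b b<x)) (cong suc (below-< w b<x))

-- Ranks ignore the order of the letters. This reduces the pattern `2 ∷ 1 ∷ p` to `1 ∷ 2 ∷ p`.
red-swap : ∀ a b w {x y p} → red (a ∷ b ∷ w) ≡ x ∷ y ∷ p → red (b ∷ a ∷ w) ≡ y ∷ x ∷ p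
red-swap a b w eq
  with e₁ , eq′ ← ∷-injective eq
  with e₂ , e₃ ← ∷-injective eq′
  = cong₂ _∷_ (trans (cong suc (below-swap b b a w)) e₂) (cong₂ _∷_ (trans (cong suc (below-swap a b a w)) e₁)
      (trans (map-cong (λ x → cong suc (below-swap x b a w)) w) e₃))

-- Two letters smaller than all of `w` raise every rank in `w` by 2. Hence a copy of `p`, whose
-- letters start at 3, is expressed by `shift (red w) ≡ p`.
shift : List ℕ → List ℕ
shift = map (2 +_)

module _ {p : List ℕ} (p≥3 : All (3 ≤_) p) where

  red-12⁻ : ∀ {a b} w → red (a ∷ b ∷ w) ≡ 1 ∷ 2 ∷ p → a < b × All (b <_) w × shift (red w) ≡ p
  red-12⁻ {a} {b} w eq
    with e₁ , eq′ ← ∷-injective eq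
    with e₂ , e₃ ← ∷-injective eq′
    with _ ∷ a≤b ∷ _ ← below≡0⇒ (a ∷ b ∷ w) (suc-injective e₁)
    = a<b , b<w , trans (sym (map-∘ w)) (trans (map-cong-∈ w λ x∈ →
        sym (cong suc (below-above w a<b (All.lookup b<w x∈)))) e₃)
    where
    a<b : a < b
    a<b = ≤∧≢⇒< a≤b λ { refl → contradiction (trans (sym e₁) e₂) λ () }
    b≤w : All (b ≤_) w
    -- Rank 2 leaves a single letter below `b`, and this is `a`.
    b≤w = All.tail (below≡0⇒ (b ∷ w) (suc-injective (trans (sym (below-< (b ∷ w) a<b)) (suc-injective e₂))))
    b<w : All (b <_) w
    -- A letter of `w` equal to `b` would also have rank 2, but `p` has no entry below 3.
    b<w = All.tabulate λ {x} x∈ → ≤∧≢⇒< (All.lookup b≤w x∈) λ { refl →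
      contradiction
        (All.lookup p≥3 (subst (2 ∈_) e₃ (subst (_∈ map (λ y → suc (below y (a ∷ b ∷ w))) w) e₂
          (∈-map⁺ (λ y → suc (below y (a ∷ b ∷ w))) x∈))))
        λ { (s≤s (s≤s ())) } }

  red-12⁺ : ∀ {a b} w → a < b → All (b <_) w → shift (red w) ≡ p → red (a ∷ b ∷ w) ≡ 1 ∷ 2 ∷ p
  red-12⁺ {a} {b} w a<b b<w eq = cong₂ _∷_
    (cong suc (⇒below≡0 (≤-refl ∷ <⇒≤ a<b ∷ All.map (λ b<x → <⇒≤ (<-trans a<b b<x)) b<w)))
    (cong₂ _∷_
      (cong suc (trans (below-< (b ∷ w) a<b) (cong suc (⇒below≡0 (≤-refl ∷ All.map <⇒≤ b<w)))))
      (trans (trans (map-cong-∈ w λ x∈ → cong suc (below-above w a<b (All.lookup b<w x∈))) (map-∘ w)) eq))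

-- The region of a pattern

Copy : List ℕ → List ℕ → ℕ → ℕ → List ℕ → Set
Copy p σ x y I = All (x <_) I × All (λ i → y < at σ i) I × shift (red (map (at σ) I)) ≡ p

-- A copy stays valid when the corner moves down or left, and it consists of points to the upper
-- right of the corner; this gives `antitone` and `local`. Searching a finite list of index tuples
-- gives `C?`.
patternRegion : (N : ℕ) → List ℕ → Region N
patternRegion N p = record
  { C        = λ σ x y → Any (Copy p σ x y) (subseqs [1‥ N ])
  ; C?       = λ σ x y → any? (λ I → All.all? (x <?_) I ×-dec All.all? (λ i → y <? at σ i) I
                                ×-dec ≡-dec _≟_ (shift (red (map (at σ) I))) p) (subseqs [1‥ N ])
  ; antitone = λ x′≤x y′≤y → Any.map λ { (xs , ys , eq) →
                 All.map (≤-<-trans x′≤x) xs , All.map (≤-<-trans y′≤y) ys , eq }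
  ; local    = λ {σ} {σ′} {x} {y} s s′ agree c →
      let I , I∈ , xs , ys , eq = find c
          al = proj₂ (to IndexTuple⇔∈ I∈)
          same : ∀ {i} → i ∈ I → at σ i ≡ at σ′ i
          same i∈ = agree (All.lookup xs i∈) (proj₂ (All.lookup al i∈)) (inj₁ (All.lookup ys i∈))
      in lose I∈ (xs , All.tabulate (λ i∈ → subst (y <_) (same i∈) (All.lookup ys i∈)) ,
           trans (cong (shift ∘ red) (sym (map-cong-∈ I same))) eq)
  }

-- Matches of the three patterns

Match : MarkedPattern → Family
Match τ σ ℓ = T (matchAt τ σ ℓ)

Match? : ∀ τ → Decides (Match τ)
Match? τ σ ℓ = T? (matchAt τ σ ℓ)

coeff≡distribution : ∀ N τ k → coeff τ N k ≡ distribution N (Match? τ) k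
coeff≡distribution N τ k = countᵇ-cong (S N) λ {σ} σ∈ → cong (_≡ᵇ k)
  (trans (cong (λ n → countᵇ (matchAt τ σ) [1‥ n ]) (Perm.len (∈-S⇒Perm {N = N} σ∈)))
         (countᵇ-cong [1‥ N ] λ {ℓ} _ → T-⇔⇒≡ (fromWitness {a? = T? (matchAt τ σ ℓ)}) toWitness))

Occurrence : ℕ → MarkedPattern → List ℕ → ℕ → Set
Occurrence N τ σ ℓ = ∃ λ I → IndexTuple N I × at I (mark τ) ≡ ℓ × red (map (at σ) I) ≡ perm τ

Match⇔Occurrence : ∀ τ → Perm N σ → ∀ {ℓ} → Match τ σ ℓ ⇔ Occurrence N τ σ ℓ
Match⇔Occurrence {N} {σ} τ s {ℓ} rewrite Perm.len s = mk⇔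
  (λ m → let I , I∈ , t = find (any⁻ test (subseqs [1‥ N ]) m)
             _ , t′ = to (T-∧ {length I ≡ᵇ length (perm τ)}) t
             t₂ , t₃ = to (T-∧ {at I (mark τ) ≡ᵇ ℓ}) t′
         in I , to IndexTuple⇔∈ I∈ , ≡ᵇ⇒≡ _ _ t₂ , toWitness t₃)
  (λ { (I , tup , eq , eq′) → any⁺ test (lose (from IndexTuple⇔∈ tup)
     -- `red` keeps the length, so the length test follows from the equality of the words.
     (from T-∧ (≡⇒≡ᵇ _ _ (trans (sym (trans (length-map _ (map (at σ) I)) (length-map (at σ) I))) (cong length eq′)) ,
      from T-∧ (≡⇒≡ᵇ _ _ eq , fromWitness eq′)))) })
  where
  test : List ℕ → Bool
  test I = (length I ≡ᵇ length (perm τ)) ∧ (at I (mark τ) ≡ᵇ ℓ) ∧ eqList (red (map (at σ) I)) (perm τ)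

module Occurrences (N : ℕ) {p : List ℕ} (p≥3 : All (3 ≤_) p) where
  open Region (patternRegion N p) using (C)
  open Statistics (patternRegion N p) using (NotMin; NotMax)

  -- Cutting the tuple after its second column leaves a copy of `p` to the right of `j`. The height
  -- `y` is kept free because the larger of the first two entries is the second for `P₁` and the
  -- first for `P₂` and `P₃`.
  pair⁻ : ∀ σ {i j I y} → IndexTuple N (i ∷ j ∷ I) →
          All (y <_) (map (at σ) I) → shift (red (map (at σ) I)) ≡ p →
          1 ≤ i × i < j × j ≤ N × C σ j y
  pair⁻ σ (((i<j ∷ _) ∷ j<I ∷ inc) , (1≤i , _) ∷ (_ , j≤N) ∷ al) above eq =
    1≤i , i<j , j≤N , lose (from IndexTuple⇔∈ (inc , al)) (j<I , All.map⁻ above , eq)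

  pair⁺ : ∀ σ {i j y} → 1 ≤ i → i < j → j ≤ N → C σ j y →
          ∃ λ I → IndexTuple N (i ∷ j ∷ I) × All (y <_) (map (at σ) I) × shift (red (map (at σ) I)) ≡ p
  pair⁺ σ {i} {j} 1≤i i<j j≤N c =
    let I , I∈ , j<I , above , eq = find c
        inc , al = to IndexTuple⇔∈ I∈
    in I , (((i<j ∷ All.map (<-trans i<j) j<I) ∷ j<I ∷ inc) ,
            (1≤i , <⇒≤ (<-≤-trans i<j j≤N)) ∷ (≤-trans 1≤i (<⇒≤ i<j) , j≤N) ∷ al) ,
       All.map⁺ above , eq

  Match-P₁ : Perm N σ → ∀ {j} → InRange N j → Match (P₁ p) σ j ⇔ NotMin σ j
  Match-P₁ {σ} s {j} (_ , j≤N) = mk⇔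
    (λ m → forward (to (Match⇔Occurrence (P₁ p) s) m))
    (λ { (c , i , i<j , 1≤i , lt) →
      let I , tup , above , eq = pair⁺ σ 1≤i i<j j≤N c in
      from (Match⇔Occurrence (P₁ p) s)
        (i ∷ j ∷ I , tup , refl , red-12⁺ p≥3 (map (at σ) I) lt above eq) })
    where
    forward : Occurrence N (P₁ p) σ j → NotMin σ j
    forward (i ∷ j ∷ I , tup , refl , eq) =
      let lt , above , eq′ = red-12⁻ p≥3 (map (at σ) I) eq
          1≤i , i<j , _ , c = pair⁻ σ tup above eq′
      in c , i , i<j , 1≤i , lt

  -- The corner takes its column from the later point and its height from the larger one. The same
  -- condition is read at `i` for `P₂` and at `j` for `P₃`.
  Inversion : List ℕ → ℕ → ℕ → Set
  Inversion σ i j = 1 ≤ i × i < j × j ≤ N × at σ j < at σ i × C σ j (at σ i)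

  red-21⁻ : ∀ σ {i j I} → IndexTuple N (i ∷ j ∷ I) → red (map (at σ) (i ∷ j ∷ I)) ≡ 2 ∷ 1 ∷ p → Inversion σ i j
  red-21⁻ σ {i} {j} {I} tup eq =
    let lt , above , eq′ = red-12⁻ p≥3 (map (at σ) I) (red-swap (at σ i) (at σ j) (map (at σ) I) eq)
        1≤i , i<j , j≤N , c = pair⁻ σ tup above eq′
    in 1≤i , i<j , j≤N , lt , c

  red-21⁺ : ∀ σ {i j} → Inversion σ i j →
            ∃ λ I → IndexTuple N (i ∷ j ∷ I) × red (map (at σ) (i ∷ j ∷ I)) ≡ 2 ∷ 1 ∷ p
  red-21⁺ σ {i} {j} (1≤i , i<j , j≤N , lt , c) =
    let I , tup , above , eq = pair⁺ σ 1≤i i<j j≤N c in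
    I , tup , red-swap (at σ j) (at σ i) (map (at σ) I) (red-12⁺ p≥3 (map (at σ) I) lt above eq)

  Match-P₂ : Perm N σ → ∀ {i} → Match (P₂ p) σ i ⇔ ∃ (Inversion σ i)
  Match-P₂ {σ} s {i} = mk⇔
    (λ m → forward (to (Match⇔Occurrence (P₂ p) s) m))
    (λ { (j , inversion) → let I , tup , eq = red-21⁺ σ inversion in
         from (Match⇔Occurrence (P₂ p) s) (i ∷ j ∷ I , tup , refl , eq) })
    where
    forward : Occurrence N (P₂ p) σ i → ∃ (Inversion σ i)
    forward (i ∷ j ∷ I , tup , refl , eq) = j , red-21⁻ σ tup eq

  Match-P₃ : Perm N σ → ∀ {j} → InRange N j → Match (P₃ p) σ j ⇔ NotMax σ j
  Match-P₃ {σ} s {j} (_ , j≤N) = mk⇔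
    (λ m → forward (to (Match⇔Occurrence (P₃ p) s) m))
    (λ { (i , i<j , 1≤i , lt , c) → let I , tup , eq = red-21⁺ σ (1≤i , i<j , j≤N , lt , c) in
         from (Match⇔Occurrence (P₃ p) s) (i ∷ j ∷ I , tup , refl , eq) })
    where
    forward : Occurrence N (P₃ p) σ j → NotMax σ j
    forward (i ∷ j ∷ I , tup , refl , eq) =
      let 1≤i , i<j , _ , lt , c = red-21⁻ σ tup eq in i , i<j , 1≤i , lt , c

-- Inversion of permutations

-- Two reindexings: within one permutation columns are renamed by their values, and then the sum
-- over permutations is reindexed by inversion.
distribution-inverse : {P Q : Family} (P? : Decides P) (Q? : Decides Q) →
  (∀ {σ} → Perm N σ → ∀ {i} → InRange N i → P σ i ⇔ Q (inv N σ) (at σ i)) →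
  ∀ k → distribution N P? k ≡ distribution N Q? k
distribution-inverse {N} P? Q? eq k = trans
  (countᵇ-cong (S N) λ {σ} σ∈ → let s = ∈-S⇒Perm σ∈ ; Q′ = λ v → ⌊ Q? (inv N σ) v ⌋ in
    cong (_≡ᵇ k) (begin
      countᵇ (λ i → ⌊ P? σ i ⌋) [1‥ N ]  ≡⟨ countᵇ-cong [1‥ N ] (λ {i} i∈ →
                                              ⌊⌋-cong (P? σ i) (Q? (inv N σ) (at σ i)) (eq s (∈-[1‥]⁻ i∈))) ⟩
      countᵇ (Q′ ∘ at σ) [1‥ N ]         ≡⟨ countᵇ-map Q′ (at σ) [1‥ N ] ⟨
      countᵇ Q′ (map (at σ) [1‥ N ])     ≡⟨ cong (countᵇ Q′) (Perm.map-at′ s) ⟩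
      countᵇ Q′ σ                        ≡⟨ countᵇ-↭ Q′ (Perm.↭-[1‥] s) ⟩
      countᵇ Q′ [1‥ N ]                  ∎))
  (countᵇ-Involution (inv-Involution {N}) (λ σ → countᵇ (λ v → ⌊ Q? σ v ⌋) [1‥ N ] ≡ᵇ k))
  where open ≡-Reasoning

-- Inversion reflects the grid in its diagonal, which exchanges right with above and maps upper
-- right quadrants to upper right quadrants.
transposeRegion : Region N → Region N
transposeRegion {N} R = record
  { C        = λ σ x y → C (inv N σ) y x
  ; C?       = λ σ x y → C? (inv N σ) y x
  ; antitone = λ x′≤x y′≤y → antitone y′≤y x′≤x
  ; local    = λ s s′ agree → local (inv-Perm s) (inv-Perm s′) (λ {v} y<v v≤N →
      let rv = ≤-trans (s≤s z≤n) y<v , v≤N in λ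
      -- The point of height `v` of one permutation lies in the quadrant, so `agree` makes it a
      -- point of the other.
      { (inj₁ x<i) → sym (inverse-agree s s′ rv (sym (agree x<i (proj₂ (inv-range s rv))
                       (inj₁ (subst (_ <_) (sym (at-inv s rv)) y<v)))))
      ; (inj₂ x<i) → inverse-agree s′ s rv (agree x<i (proj₂ (inv-range s′ rv))
                       (inj₂ (subst (_ <_) (sym (at-inv s′ rv)) y<v))) })
  }
  where
  open Region R
  inverse-agree : ∀ {σ σ′ v} → Perm N σ → Perm N σ′ → InRange N v →
    at σ′ (at (inv N σ) v) ≡ at σ (at (inv N σ) v) → at (inv N σ′) v ≡ at (inv N σ) v
  inverse-agree {σ} {σ′} {v} s s′ rv eq = begin
    at (inv N σ′) v                          ≡⟨ cong (at (inv N σ′)) (trans eq (at-inv s rv)) ⟨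
    at (inv N σ′) (at σ′ (at (inv N σ) v))   ≡⟨ inv-at s′ (inv-range s rv) ⟩
    at (inv N σ) v                           ∎
    where open ≡-Reasoning

module Transposed {N : ℕ} (R : Region N) where
  open Region R
  open Statistics R using (NotMin; NotMin?)
  module ᵀ = Statistics (transposeRegion R)

  module _ {σ} (s : Perm N σ) {i} (ri : InRange N i) where
    private
      σ⁻¹ = inv N σ

      C-inv-inv : ∀ {x y} → C (inv N σ⁻¹) x y ⇔ C σ x y
      C-inv-inv {x} {y} = mk⇔ (subst (λ ρ → C ρ x y) eq) (subst (λ ρ → C ρ x y) (sym eq))
        where eq = Involution.involutive inv-Involution s

      w<⇒range : ∀ {w} → w < at σ i → 1 ≤ w → InRange N w
      w<⇒range w< 1≤w = 1≤w , <⇒≤ (<-≤-trans w< (proj₂ (Perm.bounded s ri)))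

    -- The witness is a point to the lower left, and it stays there under reflection.
    NotMin-transpose : NotMin σ i ⇔ ᵀ.NotMin σ⁻¹ (at σ i)
    NotMin-transpose = mk⇔
      (λ { (c , k , k<i , 1≤k , lt) → let rk = 1≤k , <⇒≤ (<-≤-trans k<i (proj₂ ri)) in
           from C-inv-inv (subst (λ x → C σ x (at σ i)) (sym (inv-at s ri)) c) ,
           at σ k , lt , proj₁ (Perm.bounded s rk) , subst₂ _<_ (sym (inv-at s rk)) (sym (inv-at s ri)) k<i })
      (λ { (c , w , w< , 1≤w , lt) → let rw = w<⇒range w< 1≤w in
           subst (λ x → C σ x (at σ i)) (inv-at s ri) (to C-inv-inv c) ,
           at σ⁻¹ w , subst (at σ⁻¹ w <_) (inv-at s ri) lt , proj₁ (inv-range s rw) ,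
           subst (_< at σ i) (sym (at-inv s rw)) w< })

    -- Reflection turns a point to the lower right into one to the upper left, which is the kind of
    -- witness that `NotMax` asks for; the corner `(j , at σ i)` becomes `(at σ i , j)`.
    Inversion⇔NotMax-transpose :
      (∃ λ j → 1 ≤ i × i < j × j ≤ N × at σ j < at σ i × C σ j (at σ i)) ⇔ ᵀ.NotMax σ⁻¹ (at σ i)
    Inversion⇔NotMax-transpose = mk⇔
      (λ { (j , 1≤i , i<j , j≤N , lt , c) → let rj = ≤-trans 1≤i (<⇒≤ i<j) , j≤N in
           at σ j , lt , proj₁ (Perm.bounded s rj) ,
           subst₂ _<_ (sym (inv-at s ri)) (sym (inv-at s rj)) i<j ,
           from C-inv-inv (subst (λ x → C σ x (at σ i)) (sym (inv-at s rj)) c) })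
      (λ { (w , w< , 1≤w , lt , c) → let rw = w<⇒range w< 1≤w in
           at σ⁻¹ w , proj₁ ri , subst (_< at σ⁻¹ w) (inv-at s ri) lt , proj₂ (inv-range s rw) ,
           subst (_< at σ i) (sym (at-inv s rw)) w< , to C-inv-inv c })

-- The equivalences

module _ {p : List ℕ} (p≥3 : All (3 ≤_) p) where
  P₁~P₃ : PmpWilfEquiv (P₁ p) (P₃ p)
  P₁~P₃ N _ k = begin
    coeff (P₁ p) N k                   ≡⟨ coeff≡distribution N (P₁ p) k ⟩
    distribution N (Match? (P₁ p)) k   ≡⟨ distribution-cong (Match? (P₁ p)) NotMin? Match-P₁ k ⟩
    distribution N NotMin? k           ≡⟨ NotMin~NotMax k ⟩
    distribution N NotMax? k           ≡⟨ distribution-cong (Match? (P₃ p)) NotMax? Match-P₃ k ⟨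
    distribution N (Match? (P₃ p)) k   ≡⟨ coeff≡distribution N (P₃ p) k ⟨
    coeff (P₃ p) N k                   ∎
    where
    open Occurrences N p≥3
    open Statistics (patternRegion N p)
    open ≡-Reasoning

  -- The equidistribution is applied to the reflected region: reflection keeps the `P₁` rule in the
  -- form `NotMin` and brings the `P₂` rule into the form `NotMax`.
  P₁~P₂ : PmpWilfEquiv (P₁ p) (P₂ p)
  P₁~P₂ N _ k = begin
    coeff (P₁ p) N k                   ≡⟨ coeff≡distribution N (P₁ p) k ⟩
    distribution N (Match? (P₁ p)) k   ≡⟨ distribution-inverse (Match? (P₁ p)) ᵀ.NotMin?
                                            (λ s r → NotMin-transpose s r ⇔-∘ Match-P₁ s r) k ⟩
    distribution N ᵀ.NotMin? k         ≡⟨ ᵀ.NotMin~NotMax k ⟩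
    distribution N ᵀ.NotMax? k         ≡⟨ distribution-inverse (Match? (P₂ p)) ᵀ.NotMax?
                                            (λ s r → Inversion⇔NotMax-transpose s r ⇔-∘ Match-P₂ s) k ⟨
    distribution N (Match? (P₂ p)) k   ≡⟨ coeff≡distribution N (P₂ p) k ⟨
    coeff (P₂ p) N k                   ∎
    where
    open Occurrences N p≥3
    open Transposed (patternRegion N p)
    open ≡-Reasoning

theorem3 : (n : ℕ) → 4 ≤ n → (p : List ℕ) → p ↭ range 3 (n ∸ 2) →
    PmpWilfEquiv (P₁ p) (P₂ p) × PmpWilfEquiv (P₁ p) (P₃ p)
    × PmpWilfEquiv (P₂ p) (P₃ p)
theorem3 n _ p p↭ = P₁~P₂ p≥3 , P₁~P₃ p≥3 ,
  λ N 1≤N k → trans (sym (P₁~P₂ p≥3 N 1≤N k)) (P₁~P₃ p≥3 N 1≤N k)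
  where
  p≥3 : All (3 ≤_) p
  p≥3 = All.tabulate λ x∈ → let i , _ , eq = ∈-applyUpTo⁻ (3 +_) (∈-resp-↭ p↭ x∈) in
    subst (3 ≤_) (sym eq) (m≤m+n 3 i)
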